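{- Let $m\ge 2$ be an integer, let $d>0$, and consider the star search problem on $m$ rays with turn cost $d$. The search strategy $$x_i=\frac d2\left(\left(\frac{m}{m-1}\right)^{i}-1\right),\qquad i=1,2,3,\ldots,$$ finds every target at cost at most $$\left(1+2\frac{m^m}{(m-1)^{m-1}}\right)\mathrm{OPT}+m\left(\left(\frac{m}{m-1}\right)^{m-1}-1\right)d,$$ where $\mathrm{OPT}>0$ is the distance of the target from the origin. This strategy is optimal: if $B$ is a real number and $(x_i)_{i\ge1}$ is any search strategy that finds every target (on every ray, at every distance $\mathrm{OPT}>0$) at cost at most $\left(1+2\frac{m^m}{(m-1)^{m-1}}\right)\mathrm{OPT}+B$, then $B\ge m\left(\left(\frac{m}{m-1}\right)^{m-1}-1\right)d$.
   Context: Star search problem on $m$ rays with turn cost: an immobile target is hidden on one of $m$ rays emanating from a common origin, at an unknown distance $\mathrm{OPT}>0$ from the origin. The searcher starts at the origin and notices the target only when she reaches its position. A search strategy is a sequence $x_1,x_2,x_3,\ldots$ of positive reals with $x_{i+m}>x_i$ for all $i$, where the rays are visited cyclically: in step $i$ the searcher goes from the origin out to distance $x_i$ on ray number $i \bmod m$, turns, and comes back to the origin. Each such out-and-back step without finding the target incurs turn cost $d=d_1+d_2$ (a cost $d_1$ for turning on the ray and a cost $d_2$ for turning at the origin), in addition to the distance traveled. Explicitly, for a target at distance $t>0$ on a given ray, let $k$ be the least index such that step $k$ is on that ray and $x_k\ge t$; the cost is $2\sum_{i=1}^{k-1}x_i+(k-1)d+t$ (and $+\infty$ if no such $k$ exists).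 The number $1+2\frac{m^m}{(m-1)^{m-1}}$ is the optimal (smallest possible) competitive ratio of the star search problem without turn cost. -}

module Defs where

open import Level using (_⊔_; suc)
open import Algebra.Bundles using (CommutativeRing)
open import Data.Fin.Base using (Fin; toℕ)
open import Data.Nat.Base as ℕ using (ℕ; NonZero)
open import Data.Nat.DivMod using (_mod_)
open import Data.Product.Base using (_×_; ∃-syntax)
open import Relation.Binary.Core using (Rel)
open import Relation.Binary.PropositionalEquality.Core using (_≡_)
open import Relation.Binary.Structures using (IsStrictTotalOrder)
open import Relation.Unary using (Pred; _∈_)
import Algebra.Properties.CommutativeMonoid.Sum as Sum
import Algebra.Properties.Semiring.Exp as Exp
import Algebra.Properties.Semiring.Mult as Mult
import Relation.Binary.Construct.StrictToNonStrict as StrictToNonStrict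

-- The classical axioms of the real numbers, which determine them up to
-- isomorphism.  The order is decidable (IsStrictTotalOrder contains
-- trichotomy) and suprema exist for arbitrary predicates, so the
-- constructive reals are not an instance.

record CompleteOrderedField c ℓ₁ ℓ₂ : Set (suc (c ⊔ ℓ₁ ⊔ ℓ₂)) where
  field
    commutativeRing : CommutativeRing c ℓ₁

  open CommutativeRing commutativeRing public

  infix  4 _<_
  infix  8 _⁻¹
  infixl 7 _/_

  field
    _<_                : Rel Carrier ℓ₂
    isStrictTotalOrder : IsStrictTotalOrder _≈_ _<_

  open StrictToNonStrict _≈_ _<_ public using (_≤_)
  open Exp semiring public using (_^_)
  open Mult semiring public using () renaming (_×_ to _·_)
  open Sum +-commutativeMonoid public using (sum-syntax)

  fromℕ : ℕ → Carrier
  fromℕ n = n · 1#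

  UpperBound : Pred Carrier (c ⊔ ℓ₁ ⊔ ℓ₂) → Pred Carrier (c ⊔ ℓ₁ ⊔ ℓ₂)
  UpperBound P b = ∀ x → x ∈ P → x ≤ b

  field
    0<1        : 0# < 1#
    +-monoʳ-<  : ∀ z {x y} → x < y → z + x < z + y
    *-positive : ∀ {x y} → 0# < x → 0# < y → 0# < x * y

    -- A total function, whose value at 0# is left unspecified.
    _⁻¹        : Carrier → Carrier
    ⁻¹-cong    : ∀ {x y} → x ≈ y → x ⁻¹ ≈ y ⁻¹
    *-inverseʳ : ∀ {x} → x ≉ 0# → x * x ⁻¹ ≈ 1#

    supremum   : ∀ P → (∃[ x ] x ∈ P) → (∃[ b ] b ∈ UpperBound P) →
                 ∃[ s ] (s ∈ UpperBound P × (∀ b → b ∈ UpperBound P → s ≤ b))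

    -- Classically a consequence of supremum, which constructively yields
    -- only the double negation of the existence of n.
    archimedean : ∀ x → ∃[ n ] x < fromℕ n

  _/_ : Carrier → Carrier → Carrier
  x / y = x * y ⁻¹

-- Star search on m rays; d is the cost of the two turns of one step.

module StarSearch
  {c ℓ₁ ℓ₂} (ℝ : CompleteOrderedField c ℓ₁ ℓ₂)
  (m : ℕ) .{{_ : NonZero m}} (d : CompleteOrderedField.Carrier ℝ)
  where

  open CompleteOrderedField ℝ

  -- Steps are numbered from 1; the value at index 0 is never used.
  Steps : Set c
  Steps = ℕ → Carrier

  record IsStrategy (x : Steps) : Set ℓ₂ where
    field
      positive   : ∀ i → 1 ℕ.≤ i → 0# < x i
      increasing : ∀ i → 1 ℕ.≤ i → x i < x (i ℕ.+ m)

  record Reaches (x : Steps) (ray : Fin m) (t : Carrier) (k : ℕ) : Set (ℓ₁ ⊔ ℓ₂) where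
    field
      isStep    : 1 ℕ.≤ k
      onRay     : k mod m ≡ ray
      farEnough : t ≤ x k

  record FindsAt (x : Steps) (ray : Fin m) (t : Carrier) (k : ℕ) : Set (ℓ₁ ⊔ ℓ₂) where
    field
      reaches : Reaches x ray t k
      least   : ∀ j → Reaches x ray t j → k ℕ.≤ j

  -- 2 (x₁ + ⋯ + xₖ₋₁) + (k - 1) d + t
  cost : Steps → Carrier → ℕ → Carrier
  cost x t k =
    fromℕ 2 * (∑[ i < k ℕ.∸ 1 ] x (ℕ.suc (toℕ i))) + fromℕ (k ℕ.∸ 1) * d + t

  -- The cost is infinite when no step finds the target, so a finite bound
  -- on the cost includes the existence of such a step.
  FindsAllWithin : Steps → Carrier → Carrier → Set (c ⊔ ℓ₁ ⊔ ℓ₂)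
  FindsAllWithin x ratio B =
    ∀ (ray : Fin m) (OPT : Carrier) → 0# < OPT →
    ∃[ k ] (FindsAt x ray OPT k × cost x OPT k ≤ ratio * OPT + B)

  -- m / (m - 1), for m ≥ 2
  base : Carrier
  base = fromℕ m / fromℕ (m ℕ.∸ 1)

  competitiveRatio : Carrier
  competitiveRatio =
    1# + fromℕ 2 * (fromℕ m ^ m / fromℕ (m ℕ.∸ 1) ^ (m ℕ.∸ 1))

  additiveCost : Carrier
  additiveCost = fromℕ m * (base ^ (m ℕ.∸ 1) - 1#) * d

  optimalSteps : Steps
  optimalSteps i = d / fromℕ 2 * (base ^ i - 1#)

{-# OPTIONS --safe #-}

-- Write b = m / (m - 1) and M = m ^ m / (m - 1) ^ (m - 1) = m b ^ (m - 1) =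
-- (m - 1) b ^ m.  For the optimal strategy 2 x_i + d = d b ^ i, so the cost
-- of finding t in step k is ((m - 1) b ^ k - m) d + t; since either k ≤ m or
-- x_(k - m) < t, this is at most the claimed bound.
--
-- For the lower bound, suppose B is too small.  A target just beyond x_n is
-- found in step n + m at the earliest, so, in the limit, the partial sums V
-- of 2 x_i + d (with x_0 = 0 and a suitable initial value) are positive and
-- satisfy V (n + m) ≤ M (V (n + 1) - V n), which forces b V 0 ≤ V 1.  This
-- contradicts the initial values.
module Submission where

open import Defs
open import Algebra.Solver.Ring.AlmostCommutativeRing
  using (_-Raw-AlmostCommutative⟶_; fromCommutativeRing)
import Algebra.Properties.CommutativeSemiring.Exp as CommutativeExp
import Algebra.Properties.Ring as RingProperties
import Algebra.Properties.AbelianGroup as AbelianGroupProperties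
import Algebra.Properties.Semiring.Exp as SemiringExp
import Algebra.Properties.Semiring.Mult as SemiringMult
import Algebra.Solver.Ring
open import Data.Empty using (⊥; ⊥-elim)
open import Data.Fin.Base using (Fin; toℕ)
import Data.Fin.Properties as Fin
open import Data.Integer.Base as ℤ using (ℤ; +_; -[1+_])
import Data.Integer.Properties as ℤ
open import Data.Maybe.Base using (just; nothing)
open import Data.Nat.Base as ℕ using (ℕ; NonZero; zero; suc; z≤n; s≤s)
open import Data.Nat.DivMod using (_mod_)
import Data.Nat.DivMod as ℕ
import Data.Nat.Properties as ℕ
open import Data.Product.Base using (_×_; _,_; proj₂; ∃-syntax)
open import Data.Sum.Base using (inj₁; inj₂)
open import Function.Base using (_∘_)
open import Level using (Lift; lift; lower; _⊔_)
open import Relation.Binary.Bundles using (StrictPartialOrder)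
import Relation.Binary.Construct.StrictToNonStrict as StrictToNonStrict
open import Relation.Binary.Definitions using (tri<; tri≈; tri>; WeaklyDecidable)
open import Relation.Binary.PropositionalEquality as ≡ using (_≡_)
import Relation.Binary.Reasoning.StrictPartialOrder as StrictReasoning
open import Relation.Binary.Structures using (IsStrictTotalOrder; IsTotalOrder)
open import Relation.Nullary.Decidable.Core as Dec using (Dec; yes; no; _×-dec_)
open import Relation.Nullary.Negation.Core using (¬_)
open import Relation.Unary using (Pred; Decidable)

-- Least witnesses and residues of natural numbers.

minimal-witness : ∀ {p} {P : Pred ℕ p} → Decidable P → ∀ n → P n →
                  ∃[ k ] (P k × ∀ j → P j → k ℕ.≤ j)
minimal-witness P? zero    p = 0 , p , λ _ _ → z≤n
minimal-witness P? (suc n) p with P? 0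
... | yes p₀ = 0 , p₀ , λ _ _ → z≤n
... | no ¬p₀ with minimal-witness (P? ∘ suc) n p
...   | k , pₖ , least = suc k , pₖ , λ where
        zero    p₀ → ⊥-elim (¬p₀ p₀)
        (suc j) pⱼ → s≤s (least j pⱼ)

mod-≡⇒%-≡ : ∀ {k n} m .{{_ : NonZero m}} → k mod m ≡ n mod m → k ℕ.% m ≡ n ℕ.% m
mod-≡⇒%-≡ {k} {n} m eq =
  ≡.trans (≡.sym (Fin.toℕ-fromℕ< (ℕ.m%n<n k m)))
    (≡.trans (≡.cong toℕ eq) (Fin.toℕ-fromℕ< (ℕ.m%n<n n m)))

%-≡⇒mod-≡ : ∀ {k n} m .{{_ : NonZero m}} → k ℕ.% m ≡ n ℕ.% m → k mod m ≡ n mod m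
%-≡⇒mod-≡ {k} {n} m eq = Fin.toℕ-injective
  (≡.trans (Fin.toℕ-fromℕ< (ℕ.m%n<n k m))
    (≡.trans eq (≡.sym (Fin.toℕ-fromℕ< (ℕ.m%n<n n m)))))

toℕ-mod : ∀ {m} .{{_ : NonZero m}} (r : Fin m) → toℕ r mod m ≡ r
toℕ-mod {m} r = Fin.toℕ-injective
  (≡.trans (Fin.toℕ-fromℕ< (ℕ.m%n<n (toℕ r) m)) (ℕ.m<n⇒m%n≡m (Fin.toℕ<n r)))

-- With equal remainders, `k < n + m` compares only the quotients: `k / m` is less than `n / m + 1`.
-- The witness is therefore the difference of the quotients, where truncated subtraction loses
-- nothing.
mod-≡∧<⇒multiple : ∀ {k n} m .{{_ : NonZero m}} → k mod m ≡ n mod m → k ℕ.< n ℕ.+ m →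
                   ∃[ j ] n ≡ k ℕ.+ j ℕ.* m
mod-≡∧<⇒multiple {k} {n} m eq k<n+m = e , (begin
  n                                          ≡⟨ ℕ.m≡m%n+[m/n]*n n m ⟩
  n ℕ.% m ℕ.+ n ℕ./ m ℕ.* m                  ≡⟨ ≡.cong₂ (λ r q → r ℕ.+ q ℕ.* m) k%m≡n%m (ℕ.m+[n∸m]≡n k/m≤n/m) ⟨
  k ℕ.% m ℕ.+ (k ℕ./ m ℕ.+ e) ℕ.* m          ≡⟨ ≡.cong (k ℕ.% m ℕ.+_) (ℕ.*-distribʳ-+ m (k ℕ./ m) e) ⟩
  k ℕ.% m ℕ.+ (k ℕ./ m ℕ.* m ℕ.+ e ℕ.* m)    ≡⟨ ℕ.+-assoc (k ℕ.% m) (k ℕ./ m ℕ.* m) (e ℕ.* m) ⟨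
  k ℕ.% m ℕ.+ k ℕ./ m ℕ.* m ℕ.+ e ℕ.* m      ≡⟨ ≡.cong (ℕ._+ e ℕ.* m) (ℕ.m≡m%n+[m/n]*n k m) ⟨
  k ℕ.+ e ℕ.* m                              ∎)
  where
  open ≡.≡-Reasoning
  e = n ℕ./ m ℕ.∸ k ℕ./ m
  k%m≡n%m = mod-≡⇒%-≡ m eq

  n+m≡ : n ℕ.+ m ≡ k ℕ.% m ℕ.+ suc (n ℕ./ m) ℕ.* m
  n+m≡ = begin
    n ℕ.+ m                              ≡⟨ ≡.cong (ℕ._+ m) (ℕ.m≡m%n+[m/n]*n n m) ⟩
    n ℕ.% m ℕ.+ n ℕ./ m ℕ.* m ℕ.+ m      ≡⟨ ℕ.+-assoc (n ℕ.% m) (n ℕ./ m ℕ.* m) m ⟩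
    n ℕ.% m ℕ.+ (n ℕ./ m ℕ.* m ℕ.+ m)    ≡⟨ ≡.cong₂ ℕ._+_ (≡.sym k%m≡n%m) (ℕ.+-comm (n ℕ./ m ℕ.* m) m) ⟩
    k ℕ.% m ℕ.+ suc (n ℕ./ m) ℕ.* m      ∎

  k/m≤n/m : k ℕ./ m ℕ.≤ n ℕ./ m
  k/m≤n/m = ℕ.s≤s⁻¹ (ℕ.*-cancelʳ-< m (k ℕ./ m) (suc (n ℕ./ m))
    (ℕ.+-cancelˡ-< (k ℕ.% m) _ _ (≡.subst₂ ℕ._<_ (ℕ.m≡m%n+[m/n]*n k m) n+m≡ k<n+m)))

-- A ring solver with integer coefficients for the abstract field.

module OrderedFieldProperties {c ℓ₁ ℓ₂} (ℝ : CompleteOrderedField c ℓ₁ ℓ₂) where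

  open CompleteOrderedField ℝ
  open SemiringMult semiring using (×-homo-+; ×1-homo-*; ×-homo-1)
  open RingProperties ring using (-‿distribˡ-*; -‿distribʳ-*)
  open AbelianGroupProperties +-abelianGroup using (⁻¹-involutive; ⁻¹-∙-comm; ε⁻¹≈ε)

  -- The value 1# at 1, rather than 1# + 0#, lets the ring solver use the
  -- constant 1 for 1# itself.
  fromℕ′ : ℕ → Carrier
  fromℕ′ 1 = 1#
  fromℕ′ n = fromℕ n

  fromℕ′≈fromℕ : ∀ n → fromℕ′ n ≈ fromℕ n
  fromℕ′≈fromℕ 0             = refl
  fromℕ′≈fromℕ 1             = sym (×-homo-1 1#)
  fromℕ′≈fromℕ (suc (suc n)) = refl

  fromℤ : ℤ → Carrier
  fromℤ (+ n)    = fromℕ′ n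
  fromℤ -[1+ n ] = - fromℕ′ (suc n)

  module ℤ-homomorphism where
    open import Relation.Binary.Reasoning.Setoid setoid

    fromℕ′-+ : ∀ m n → fromℕ′ (m ℕ.+ n) ≈ fromℕ′ m + fromℕ′ n
    fromℕ′-+ m n = begin
      fromℕ′ (m ℕ.+ n)     ≈⟨ fromℕ′≈fromℕ (m ℕ.+ n) ⟩
      fromℕ (m ℕ.+ n)      ≈⟨ ×-homo-+ 1# m n ⟩
      fromℕ m + fromℕ n    ≈⟨ +-cong (fromℕ′≈fromℕ m) (fromℕ′≈fromℕ n) ⟨
      fromℕ′ m + fromℕ′ n  ∎

    fromℕ′-* : ∀ m n → fromℕ′ (m ℕ.* n) ≈ fromℕ′ m * fromℕ′ n
    fromℕ′-* m n = begin
      fromℕ′ (m ℕ.* n)     ≈⟨ fromℕ′≈fromℕ (m ℕ.* n) ⟩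
      fromℕ (m ℕ.* n)      ≈⟨ ×1-homo-* m n ⟩
      fromℕ m * fromℕ n    ≈⟨ *-cong (fromℕ′≈fromℕ m) (fromℕ′≈fromℕ n) ⟨
      fromℕ′ m * fromℕ′ n  ∎

    fromℤ-⊖ : ∀ m n → fromℤ (m ℤ.⊖ n) ≈ fromℕ′ m - fromℕ′ n
    fromℤ-⊖ m zero = begin
      fromℕ′ m          ≈⟨ +-identityʳ _ ⟨
      fromℕ′ m + 0#     ≈⟨ +-congˡ ε⁻¹≈ε ⟨
      fromℕ′ m - 0#     ∎
    fromℤ-⊖ zero (suc n) = sym (+-identityˡ _)
    fromℤ-⊖ (suc m) (suc n) = begin
      fromℤ (suc m ℤ.⊖ suc n)                    ≡⟨ ≡.cong fromℤ (ℤ.[1+m]⊖[1+n]≡m⊖n m n) ⟩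
      fromℤ (m ℤ.⊖ n)                            ≈⟨ fromℤ-⊖ m n ⟩
      fromℕ′ m - fromℕ′ n                        ≈⟨ +-congʳ (+-identityʳ _) ⟨
      fromℕ′ m + 0# - fromℕ′ n                   ≈⟨ +-congʳ (+-congˡ (-‿inverseʳ 1#)) ⟨
      fromℕ′ m + (1# - 1#) - fromℕ′ n            ≈⟨ +-congʳ (+-assoc _ _ _) ⟨
      fromℕ′ m + 1# - 1# - fromℕ′ n              ≈⟨ +-assoc _ _ _ ⟩
      (fromℕ′ m + 1#) + (- 1# - fromℕ′ n)        ≈⟨ +-cong (+-comm _ _) (⁻¹-∙-comm _ _) ⟩
      (1# + fromℕ′ m) - (1# + fromℕ′ n)          ≈⟨ +-cong (fromℕ′-+ 1 m) (-‿cong (fromℕ′-+ 1 n)) ⟨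
      fromℕ′ (suc m) - fromℕ′ (suc n)            ∎

    fromℤ-neg : ∀ i → fromℤ (ℤ.- i) ≈ - fromℤ i
    fromℤ-neg (+ zero)   = sym ε⁻¹≈ε
    fromℤ-neg (+ suc n)  = refl
    fromℤ-neg (-[1+ n ]) = sym (⁻¹-involutive _)

    fromℤ-+ : ∀ i j → fromℤ (i ℤ.+ j) ≈ fromℤ i + fromℤ j
    fromℤ-+ (+ m)    (+ n)    = fromℕ′-+ m n
    fromℤ-+ (+ m)    -[1+ n ] = fromℤ-⊖ m (suc n)
    fromℤ-+ -[1+ m ] (+ n)    = trans (fromℤ-⊖ n (suc m)) (+-comm _ _)
    fromℤ-+ -[1+ m ] -[1+ n ] = begin
      - fromℕ′ (suc (suc (m ℕ.+ n)))     ≡⟨ ≡.cong (λ k → - fromℕ′ (suc k)) (ℕ.+-suc m n) ⟨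
      - fromℕ′ (suc m ℕ.+ suc n)         ≈⟨ -‿cong (fromℕ′-+ (suc m) (suc n)) ⟩
      - (fromℕ′ (suc m) + fromℕ′ (suc n)) ≈⟨ ⁻¹-∙-comm _ _ ⟨
      - fromℕ′ (suc m) - fromℕ′ (suc n)  ∎

    fromℤ-+* : ∀ m j → fromℤ (+ m ℤ.* j) ≈ fromℕ′ m * fromℤ j
    fromℤ-+* m (+ n) = begin
      fromℤ (+ m ℤ.* + n)   ≡⟨ ≡.cong fromℤ (ℤ.pos-* m n) ⟨
      fromℕ′ (m ℕ.* n)      ≈⟨ fromℕ′-* m n ⟩
      fromℕ′ m * fromℕ′ n   ∎
    fromℤ-+* m -[1+ n ] = begin
      fromℤ (+ m ℤ.* -[1+ n ])         ≡⟨ ≡.cong fromℤ (ℤ.neg-distribʳ-* (+ m) (+ suc n)) ⟨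
      fromℤ (ℤ.- (+ m ℤ.* + suc n))    ≈⟨ fromℤ-neg (+ m ℤ.* + suc n) ⟩
      - fromℤ (+ m ℤ.* + suc n)        ≈⟨ -‿cong (fromℤ-+* m (+ suc n)) ⟩
      - (fromℕ′ m * fromℕ′ (suc n))    ≈⟨ -‿distribʳ-* _ _ ⟩
      fromℕ′ m * - fromℕ′ (suc n)      ∎

    fromℤ-* : ∀ i j → fromℤ (i ℤ.* j) ≈ fromℤ i * fromℤ j
    fromℤ-* (+ m)    j = fromℤ-+* m j
    fromℤ-* -[1+ m ] j = begin
      fromℤ (-[1+ m ] ℤ.* j)        ≡⟨ ≡.cong fromℤ (ℤ.neg-distribˡ-* (+ suc m) j) ⟨
      fromℤ (ℤ.- (+ suc m ℤ.* j))   ≈⟨ fromℤ-neg (+ suc m ℤ.* j) ⟩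
      - fromℤ (+ suc m ℤ.* j)       ≈⟨ -‿cong (fromℤ-+* (suc m) j) ⟩
      - (fromℕ′ (suc m) * fromℤ j)  ≈⟨ -‿distribˡ-* _ _ ⟩
      - fromℕ′ (suc m) * fromℤ j    ∎

    fromℤ-homomorphism : ℤ.+-*-rawRing -Raw-AlmostCommutative⟶ fromCommutativeRing commutativeRing
    fromℤ-homomorphism = record
      { ⟦_⟧    = fromℤ
      ; +-homo = fromℤ-+
      ; *-homo = fromℤ-*
      ; -‿homo = fromℤ-neg
      ; 0-homo = refl
      ; 1-homo = refl
      }

    -- The test compares the integers themselves, because it has to compute during normalisation;
    -- trichotomy in an abstract field does not reduce.
    fromℤ-≟ : WeaklyDecidable (λ i j → fromℤ i ≈ fromℤ j)
    fromℤ-≟ i j with i ℤ.≟ j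
    ... | yes ≡.refl = just refl
    ... | no _       = nothing

  open Algebra.Solver.Ring ℤ.+-*-rawRing (fromCommutativeRing commutativeRing)
    ℤ-homomorphism.fromℤ-homomorphism ℤ-homomorphism.fromℤ-≟ public
    using (solve; con; _:+_; _:*_; _:-_; _:=_)

  -- Order, monotonicity and powers.

  open IsStrictTotalOrder isStrictTotalOrder public
    using (compare; isStrictPartialOrder)
    renaming (trans to <-trans; irrefl to <-irrefl; asym to <-asym;
              <-respʳ-≈ to <-respʳ; <-respˡ-≈ to <-respˡ)

  open StrictToNonStrict _≈_ _<_ using (isTotalOrder; decidable′)
  open IsTotalOrder (isTotalOrder isStrictTotalOrder) public
    using () renaming (trans to ≤-trans; ≤-respʳ-≈ to ≤-respʳ; ≤-respˡ-≈ to ≤-respˡ)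

  strictPartialOrder : StrictPartialOrder c ℓ₁ ℓ₂
  strictPartialOrder = record { isStrictPartialOrder = isStrictPartialOrder }

  module ≤-Reasoning = StrictReasoning strictPartialOrder

  <-≤-trans : ∀ {x y z} → x < y → y ≤ z → x < z
  <-≤-trans = StrictToNonStrict.<-≤-trans _≈_ _<_ <-trans <-respʳ

  ≤-<-trans : ∀ {x y z} → x ≤ y → y < z → x < z
  ≤-<-trans = StrictToNonStrict.≤-<-trans _≈_ _<_ sym <-trans <-respˡ

  infix 4 _≤?_

  _≤?_ : ∀ x y → Dec (x ≤ y)
  _≤?_ = decidable′ compare

  ≤-refl : ∀ {x} → x ≤ x
  ≤-refl = inj₂ refl

  <⇒≱ : ∀ {x y} → x < y → ¬ y ≤ x
  <⇒≱ x<y (inj₁ y<x) = <-asym x<y y<x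
  <⇒≱ x<y (inj₂ y≈x) = <-irrefl (sym y≈x) x<y

  ≰⇒> : ∀ {x y} → ¬ x ≤ y → y < x
  ≰⇒> {x} {y} x≰y with compare x y
  ... | tri< x<y _ _ = ⊥-elim (x≰y (inj₁ x<y))
  ... | tri≈ _ x≈y _ = ⊥-elim (x≰y (inj₂ x≈y))
  ... | tri> _ _ y<x = y<x

  ≮⇒≥ : ∀ {x y} → ¬ x < y → y ≤ x
  ≮⇒≥ {x} {y} x≮y with compare x y
  ... | tri< x<y _ _ = ⊥-elim (x≮y x<y)
  ... | tri≈ _ x≈y _ = inj₂ (sym x≈y)
  ... | tri> _ _ y<x = inj₁ y<x

  <⇒0<- : ∀ {x y} → x < y → 0# < y - x
  <⇒0<- {x} {y} x<y = <-respʳ (+-comm (- x) y)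
    (<-respˡ (-‿inverseˡ x) (+-monoʳ-< (- x) x<y))

  ≤⇒0≤- : ∀ {x y} → x ≤ y → 0# ≤ y - x
  ≤⇒0≤- (inj₁ x<y)         = inj₁ (<⇒0<- x<y)
  ≤⇒0≤- {x} {y} (inj₂ x≈y) = inj₂ (sym (trans (+-congʳ (sym x≈y)) (-‿inverseʳ x)))

  x+[y-x]≈y : ∀ x y → x + (y - x) ≈ y
  x+[y-x]≈y = solve 2 (λ x y → x :+ (y :- x) := y) refl

  -- Inequalities are reduced to the sign of a difference, computed by the
  -- ring solver.
  <-by-difference : ∀ {x y e} → 0# < e → y - x ≈ e → x < y
  <-by-difference {x} {y} 0<e y-x≈e =
    <-respʳ (x+[y-x]≈y x y) (<-respˡ (+-identityʳ x)
      (+-monoʳ-< x (<-respʳ (sym y-x≈e) 0<e)))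

  ≤-by-difference : ∀ {x y e} → 0# ≤ e → y - x ≈ e → x ≤ y
  ≤-by-difference (inj₁ 0<e) y-x≈e = inj₁ (<-by-difference 0<e y-x≈e)
  ≤-by-difference {x} {y} (inj₂ 0≈e) y-x≈e = inj₂ (begin
    x            ≈⟨ +-identityʳ x ⟨
    x + 0#       ≈⟨ +-congˡ (trans y-x≈e (sym 0≈e)) ⟨
    x + (y - x)  ≈⟨ x+[y-x]≈y x y ⟩
    y            ∎)
    where open import Relation.Binary.Reasoning.Setoid setoid

  +-positive : ∀ {x y} → 0# < x → 0# ≤ y → 0# < x + y
  +-positive {x} 0<x (inj₁ 0<y) =
    <-trans 0<x (<-respˡ (+-identityʳ x) (+-monoʳ-< x 0<y))
  +-positive {x} 0<x (inj₂ 0≈y) =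
    <-respʳ (trans (sym (+-identityʳ x)) (+-congˡ 0≈y)) 0<x

  +-nonNegative : ∀ {x y} → 0# ≤ x → 0# ≤ y → 0# ≤ x + y
  +-nonNegative     (inj₁ 0<x) 0≤y = inj₁ (+-positive 0<x 0≤y)
  +-nonNegative {x} {y} (inj₂ 0≈x) 0≤y =
    ≤-respʳ (trans (sym (+-identityˡ y)) (+-congʳ 0≈x)) 0≤y

  *-nonNegative : ∀ {x y} → 0# ≤ x → 0# ≤ y → 0# ≤ x * y
  *-nonNegative (inj₁ 0<x) (inj₁ 0<y) = inj₁ (*-positive 0<x 0<y)
  *-nonNegative {x} (inj₁ 0<x) (inj₂ 0≈y) =
    inj₂ (trans (sym (zeroʳ x)) (*-congˡ 0≈y))
  *-nonNegative {y = y} (inj₂ 0≈x) 0≤y =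
    inj₂ (trans (sym (zeroˡ y)) (*-congʳ 0≈x))

  *-monoˡ-< : ∀ {a x y} → 0# < a → x < y → a * x < a * y
  *-monoˡ-< {a} {x} {y} 0<a x<y = <-by-difference (*-positive 0<a (<⇒0<- x<y))
    (solve 3 (λ a x y → a :* y :- a :* x := a :* (y :- x)) refl a x y)

  *-monoˡ-≤ : ∀ {a x y} → 0# ≤ a → x ≤ y → a * x ≤ a * y
  *-monoˡ-≤ {a} {x} {y} 0≤a x≤y = ≤-by-difference (*-nonNegative 0≤a (≤⇒0≤- x≤y))
    (solve 3 (λ a x y → a :* y :- a :* x := a :* (y :- x)) refl a x y)

  *-cancelˡ-≤ : ∀ {a x y} → 0# < a → a * x ≤ a * y → x ≤ y
  *-cancelˡ-≤ 0<a ax≤ay = ≮⇒≥ λ y<x → <⇒≱ (*-monoˡ-< 0<a y<x) ax≤ay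

  *-cancelˡ-< : ∀ {a x y} → 0# < a → a * x < a * y → x < y
  *-cancelˡ-< 0<a ax<ay = ≰⇒> λ y≤x → <⇒≱ ax<ay (*-monoˡ-≤ (inj₁ 0<a) y≤x)

  0≤1 : 0# ≤ 1#
  0≤1 = inj₁ 0<1

  fromℕ-nonNegative : ∀ n → 0# ≤ fromℕ n
  fromℕ-nonNegative zero    = ≤-refl
  fromℕ-nonNegative (suc n) = +-nonNegative 0≤1 (fromℕ-nonNegative n)

  fromℕ-positive : ∀ n → 0# < fromℕ (suc n)
  fromℕ-positive n = +-positive 0<1 (fromℕ-nonNegative n)

  fromℕ-mono-≤ : ∀ {m n} → m ℕ.≤ n → fromℕ m ≤ fromℕ n
  fromℕ-mono-≤ {n = n} z≤n = fromℕ-nonNegative n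
  fromℕ-mono-≤ {suc m} {suc n} (s≤s m≤n) = ≤-by-difference (≤⇒0≤- (fromℕ-mono-≤ m≤n))
    (solve 2 (λ m n → (con (+ 1) :+ n) :- (con (+ 1) :+ m) := n :- m) refl (fromℕ m) (fromℕ n))

  ^-positive : ∀ {x} → 0# < x → ∀ n → 0# < x ^ n
  ^-positive 0<x zero    = 0<1
  ^-positive 0<x (suc n) = *-positive 0<x (^-positive 0<x n)

  1≤^ : ∀ {x} → 1# ≤ x → ∀ n → 1# ≤ x ^ n
  1≤^ 1≤x zero = ≤-refl
  1≤^ {x} 1≤x (suc n) = begin
    1#          ≤⟨ 1≤x ⟩
    x           ≈⟨ *-identityʳ x ⟨
    x * 1#      ≤⟨ *-monoˡ-≤ (≤-trans 0≤1 1≤x) (1≤^ 1≤x n) ⟩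
    x * x ^ n   ∎
    where open ≤-Reasoning

  ^-monoʳ-≤ : ∀ {x} → 1# ≤ x → ∀ {m n} → m ℕ.≤ n → x ^ m ≤ x ^ n
  ^-monoʳ-≤ 1≤x {n = n} z≤n   = 1≤^ 1≤x n
  ^-monoʳ-≤ 1≤x (s≤s m≤n) = *-monoˡ-≤ (≤-trans 0≤1 1≤x) (^-monoʳ-≤ 1≤x m≤n)

  ^-sucʳ-< : ∀ {x} → 1# < x → ∀ n → x ^ n < x ^ suc n
  ^-sucʳ-< {x} 1<x n = <-by-difference
    (*-positive (^-positive (<-trans 0<1 1<x) n) (<⇒0<- 1<x))
    (solve 2 (λ x p → x :* p :- p := p :* (x :- con (+ 1))) refl x (x ^ n))

  ^-monoʳ-< : ∀ {x} → 1# < x → ∀ {m n} → m ℕ.< n → x ^ m < x ^ n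
  ^-monoʳ-< {x} 1<x {m} {n} m<n = begin-strict
    x ^ m        <⟨ ^-sucʳ-< 1<x m ⟩
    x ^ suc m    ≤⟨ ^-monoʳ-≤ (inj₁ 1<x) m<n ⟩
    x ^ n        ∎
    where open ≤-Reasoning

  -- Division, limits and critical growth rates.

  *-⁻¹ : ∀ {x} → 0# < x → x * x ⁻¹ ≈ 1#
  *-⁻¹ 0<x = *-inverseʳ λ x≈0 → <-irrefl (sym x≈0) 0<x

  *-/-cancel : ∀ {x} y → 0# < x → x * (y / x) ≈ y
  *-/-cancel {x} y 0<x = begin
    x * (y * x ⁻¹)  ≈⟨ solve 3 (λ x y z → x :* (y :* z) := y :* (x :* z)) refl x y (x ⁻¹) ⟩
    y * (x * x ⁻¹)  ≈⟨ *-congˡ (*-⁻¹ 0<x) ⟩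
    y * 1#          ≈⟨ *-identityʳ y ⟩
    y               ∎
    where open import Relation.Binary.Reasoning.Setoid setoid

  /-positive : ∀ {x y} → 0# < x → 0# < y → 0# < y / x
  /-positive {x} {y} 0<x 0<y = *-cancelˡ-< 0<x
    (<-respˡ (sym (zeroʳ x)) (<-respʳ (sym (*-/-cancel y 0<x)) 0<y))

  -- Continuity of an affine function at `a`. If the bound failed at `a` by a gap `w`, then moving
  -- by `w / (2 e)` would close only half of the gap, so the bound would still fail at a point
  -- beyond `a`.
  ≤-at-limit : ∀ {a e f z} → 0# < e → (∀ t → a < t → z ≤ e * t + f) → z ≤ e * a + f
  ≤-at-limit {a} {e} {f} {z} 0<e bound = ≮⇒≥ λ ea+f<z →
    let w   = z - (e * a + f)
        δ   = w / (fromℕ 2 * e)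
        0<2e = *-positive (fromℕ-positive 1) 0<e
        0<δ = /-positive 0<2e (<⇒0<- ea+f<z)
        2eδ≈w = *-/-cancel w 0<2e
        z≤  = bound (a + δ) (<-by-difference 0<δ (solve 2 (λ a δ → a :+ δ :- a := δ) refl a δ))
    -- As `2 e δ = w`, the slack at `a` is twice the slack at `a + δ`, which is nonnegative.
    in <⇒≱ ea+f<z (≤-by-difference
         (*-nonNegative (fromℕ-nonNegative 2) (≤⇒0≤- z≤)) (begin
           e * a + f - z
             ≈⟨ solve 4 (λ e a f z → e :* a :+ f :- z :=
                  con (+ 2) :* (e :* a :+ f :- z) :+ (z :- (e :* a :+ f))) refl e a f z ⟩
           fromℕ 2 * (e * a + f - z) + w
             ≈⟨ +-congˡ 2eδ≈w ⟨
           fromℕ 2 * (e * a + f - z) + fromℕ 2 * e * δ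
             ≈⟨ solve 5 (λ e a f z δ → con (+ 2) :* (e :* a :+ f :- z) :+ con (+ 2) :* e :* δ :=
                  con (+ 2) :* (e :* (a :+ δ) :+ f :- z)) refl e a f z δ ⟩
           fromℕ 2 * (e * (a + δ) + f - z) ∎))
    where open import Relation.Binary.Reasoning.Setoid setoid

  -- With n = 2 + k, the graph of the n-th power lies strictly above its tangent at `a`. Let E k be
  -- the right side minus the left. Then E 0 = (a - x)^2 and E (k + 1) = x E k + (k + 2) a^(k + 1)
  -- (a - x)^2, so positivity follows by induction.
  strict-Bernoulli : ∀ {a x} → 0# < x → x < a → ∀ k →
    fromℕ (2 ℕ.+ k) * a ^ suc k * x < x ^ (2 ℕ.+ k) + fromℕ (suc k) * a ^ (2 ℕ.+ k)
  strict-Bernoulli {a} {x} 0<x x<a zero =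
    <-by-difference (*-positive 0<a-x 0<a-x)
      (solve 2 (λ a x → (x :* (x :* con (+ 1)) :+ (con (+ 1) :+ con (+ 0)) :* (a :* (a :* con (+ 1))))
          :- (con (+ 1) :+ (con (+ 1) :+ con (+ 0))) :* (a :* con (+ 1)) :* x
        := (a :- x) :* (a :- x)) refl a x)
    where 0<a-x = <⇒0<- x<a
  strict-Bernoulli {a} {x} 0<x x<a (suc k) =
    <-by-difference
      (+-positive (*-positive 0<x (<⇒0<- (strict-Bernoulli 0<x x<a k)))
        (inj₁ (*-positive (*-positive (fromℕ-positive (suc k)) (^-positive (<-trans 0<x x<a) (suc k)))
          (*-positive 0<a-x 0<a-x))))
      (solve 5 (λ a x n p r →
          (x :* r :+ (con (+ 1) :+ n) :* (a :* (a :* p))) :- (con (+ 1) :+ (con (+ 1) :+ n)) :* (a :* p) :* x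
        := x :* (r :+ n :* (a :* p) :- (con (+ 1) :+ n) :* p :* x)
           :+ (con (+ 1) :+ n) :* p :* ((a :- x) :* (a :- x)))
        refl a x (fromℕ (suc k)) (a ^ suc k) (x ^ (2 ℕ.+ k)))
    where 0<a-x = <⇒0<- x<a

  ∑-last : ∀ (f : ℕ → Carrier) n →
           ∑[ i < suc n ] f (toℕ i) ≈ ∑[ i < n ] f (toℕ i) + f n
  ∑-last f zero    = +-comm (f 0) 0#
  ∑-last f (suc n) = trans (+-congˡ (∑-last (f ∘ suc) n)) (sym (+-assoc _ _ _))

  -- r is the critical ratio: the characteristic polynomial of the recurrence
  -- V (2 + k + n) = M (V (1 + n) - V n) has r as a double root.  The largest
  -- ρ with ρ V n ≤ V (1 + n) for all n satisfies ρ ≥ M / (M - ρ ^ (1 + k)),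
  -- which strict-Bernoulli refutes for ρ < r.
  module CriticalGrowth
    (k : ℕ) {r M : Carrier} (0<r : 0# < r)
    (M≈[2+k]r^[1+k] : M ≈ fromℕ (2 ℕ.+ k) * r ^ suc k)
    (M≈[1+k]r^[2+k] : M ≈ fromℕ (suc k) * r ^ (2 ℕ.+ k))
    (V : ℕ → Carrier) (V-positive : ∀ n → 0# < V n)
    (V-recurrence : ∀ n → V (2 ℕ.+ k ℕ.+ n) ≤ M * (V (suc n) - V n))
    where

    Rate : Pred Carrier (ℓ₁ ⊔ ℓ₂)
    Rate s = ∀ n → s * V n ≤ V (suc n)

    0<M : 0# < M
    0<M = <-respʳ (sym M≈[1+k]r^[2+k])
      (*-positive (fromℕ-positive k) (^-positive 0<r (2 ℕ.+ k)))

    -- A first element for the set of rates: the left side of the recurrence is positive, hence so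
    -- is the increment of `V`.
    rate-1 : Rate 1#
    rate-1 n = ≤-respˡ (sym (*-identityˡ (V n))) (inj₁ V[n]<V[1+n])
      where
      open ≤-Reasoning
      V[n]<V[1+n] : V n < V (suc n)
      V[n]<V[1+n] = <-by-difference
        (*-cancelˡ-< 0<M (begin-strict
          M * 0#                  ≈⟨ zeroʳ M ⟩
          0#                      <⟨ V-positive (2 ℕ.+ k ℕ.+ n) ⟩
          V (2 ℕ.+ k ℕ.+ n)       ≤⟨ V-recurrence n ⟩
          M * (V (suc n) - V n)   ∎)) refl

    rate-^ : ∀ {s} → 0# ≤ s → Rate s → ∀ i n → s ^ i * V n ≤ V (i ℕ.+ n)
    rate-^ 0≤s rate zero n = inj₂ (*-identityˡ (V n))
    rate-^ {s} 0≤s rate (suc i) n = begin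
      s * s ^ i * V n      ≈⟨ *-assoc s (s ^ i) (V n) ⟩
      s * (s ^ i * V n)    ≤⟨ *-monoˡ-≤ 0≤s (rate-^ 0≤s rate i n) ⟩
      s * V (i ℕ.+ n)      ≤⟨ rate (i ℕ.+ n) ⟩
      V (suc (i ℕ.+ n))    ∎
      where open ≤-Reasoning

    -- Going from `V (1 + n)` to `V (2 + k + n)` at rate `s` bounds the left side of the recurrence
    -- below by `s ^ (1 + k) * V (1 + n)`. Solving for `V (1 + n)` gives the new rate `M / D`.
    larger-rate : ∀ {s} → 1# ≤ s → s < r → Rate s → ∃[ s′ ] (Rate s′ × s < s′)
    larger-rate {s} 1≤s s<r rate = M / D , rate′ , *-cancelˡ-< 0<D Ds<M
      where
      open ≤-Reasoning
      D = M - s ^ suc k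

      0<s : 0# < s
      0<s = <-≤-trans 0<1 1≤s

      MV≤DV : ∀ n → M * V n ≤ D * V (suc n)
      MV≤DV n = ≤-by-difference
        (≤⇒0≤- (begin
          s ^ suc k * V (suc n)    ≤⟨ rate-^ (inj₁ 0<s) rate (suc k) (suc n) ⟩
          V (suc k ℕ.+ suc n)      ≡⟨ ≡.cong (V ∘ suc) (ℕ.+-suc k n) ⟩
          V (2 ℕ.+ k ℕ.+ n)        ≤⟨ V-recurrence n ⟩
          M * (V (suc n) - V n)    ∎))
        (solve 4 (λ M p v w → (M :- p) :* w :- M :* v := M :* (w :- v) :- p :* w)
          refl M (s ^ suc k) (V n) (V (suc n)))

      -- The sign of `D` is read off from `MV≤DV` at 0, where both values of `V` and `M` are
      -- positive.
      0<D : 0# < D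
      0<D = *-cancelˡ-< (V-positive 1) (begin-strict
        V 1 * 0#    ≈⟨ zeroʳ (V 1) ⟩
        0#          <⟨ *-positive 0<M (V-positive 0) ⟩
        M * V 0     ≤⟨ MV≤DV 0 ⟩
        D * V 1     ≈⟨ *-comm D (V 1) ⟩
        V 1 * D     ∎)

      rate′ : Rate (M / D)
      rate′ n = *-cancelˡ-≤ 0<D (begin
        D * (M / D * V n)    ≈⟨ *-assoc D (M / D) (V n) ⟨
        D * (M / D) * V n    ≈⟨ *-congʳ (*-/-cancel M 0<D) ⟩
        M * V n              ≤⟨ MV≤DV n ⟩
        D * V (suc n)        ∎)

      -- Bernoulli's inequality at `a = r`: the two expressions for `M` are the slope and the
      -- constant term of the tangent. Rearranged, it says `D * s < M`.
      Ms<s^[2+k]+M : M * s < s ^ (2 ℕ.+ k) + M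
      Ms<s^[2+k]+M = begin-strict
        M * s                                                ≈⟨ *-congʳ M≈[2+k]r^[1+k] ⟩
        fromℕ (2 ℕ.+ k) * r ^ suc k * s                      <⟨ strict-Bernoulli 0<s s<r k ⟩
        s ^ (2 ℕ.+ k) + fromℕ (suc k) * r ^ (2 ℕ.+ k)        ≈⟨ +-congˡ M≈[1+k]r^[2+k] ⟨
        s ^ (2 ℕ.+ k) + M                                    ∎

      Ds<M : D * s < D * (M / D)
      Ds<M = <-respʳ (sym (*-/-cancel M 0<D)) (<-by-difference (<⇒0<- Ms<s^[2+k]+M)
        (solve 3 (λ M s p → M :- (M :- p) :* s := s :* p :+ M :- M :* s)
          refl M s (s ^ suc k)))

    -- The supremum of the rates is itself a rate and is at most `V 1 / V 0`. Were that ratio below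
    -- `r`, `larger-rate` would exceed the supremum.
    critical-growth : r * V 0 ≤ V 1
    critical-growth = ≮⇒≥ λ V₁<rV₀ →
      let (ρ , ρ-upper , ρ-least) = supremum
            -- `Lift` only raises the universe level to the one that `supremum` expects.
            (λ s → Lift c (Rate s)) (1# , lift rate-1)
            (V 1 / V 0 , λ s rate → upper (lower rate) 0)
          ρ-rate : Rate ρ
          -- Each ratio `V (1 + n) / V n` is an upper bound of the rates, so the least upper bound
          -- lies below all of them: the supremum is attained.
          ρ-rate n = rate-from-upper n (ρ-least (V (suc n) / V n) λ s rate → upper (lower rate) n)
          ρ<r = *-cancelˡ-< (V-positive 0) (begin-strict
            V 0 * ρ    ≈⟨ *-comm (V 0) ρ ⟩
            ρ * V 0    ≤⟨ ρ-rate 0 ⟩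
            V 1        <⟨ V₁<rV₀ ⟩
            r * V 0    ≈⟨ *-comm r (V 0) ⟩
            V 0 * r    ∎)
          (ρ′ , ρ′-rate , ρ<ρ′) = larger-rate (ρ-upper 1# (lift rate-1)) ρ<r ρ-rate
      in <⇒≱ ρ<ρ′ (ρ-upper ρ′ (lift ρ′-rate))
      where
      open ≤-Reasoning
      upper : ∀ {s} → Rate s → ∀ n → s ≤ V (suc n) / V n
      upper {s} rate n = *-cancelˡ-≤ (V-positive n) (begin
        V n * s                    ≈⟨ *-comm (V n) s ⟩
        s * V n                    ≤⟨ rate n ⟩
        V (suc n)                  ≈⟨ *-/-cancel (V (suc n)) (V-positive n) ⟨
        V n * (V (suc n) / V n)    ∎)

      rate-from-upper : ∀ {s} n → s ≤ V (suc n) / V n → s * V n ≤ V (suc n)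
      rate-from-upper {s} n s≤ = begin
        s * V n                    ≈⟨ *-comm s (V n) ⟩
        V n * s                    ≤⟨ *-monoˡ-≤ (inj₁ (V-positive n)) s≤ ⟩
        V n * (V (suc n) / V n)    ≈⟨ *-/-cancel (V (suc n)) (V-positive n) ⟩
        V (suc n)                  ∎

-- Constants of the star search problem.

module StarSearchProperties
  {c ℓ₁ ℓ₂} (ℝ : CompleteOrderedField c ℓ₁ ℓ₂) (p : ℕ)
  (d : CompleteOrderedField.Carrier ℝ)
  (0<d : CompleteOrderedField._<_ ℝ (CompleteOrderedField.0# ℝ) d)
  where

  open CompleteOrderedField ℝ
  open OrderedFieldProperties ℝ
  open CommutativeExp commutativeSemiring using (^-distrib-*)
  open SemiringExp semiring using (^-congˡ; ^-homo-*)

  m = 2 ℕ.+ p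

  open StarSearch ℝ m d

  q M h : Carrier
  q = fromℕ (suc p)
  M = fromℕ m ^ m / q ^ suc p
  h = d / fromℕ 2

  0<q : 0# < q
  0<q = fromℕ-positive p

  2h≈d : fromℕ 2 * h ≈ d
  2h≈d = *-/-cancel d (fromℕ-positive 1)

  0<h : 0# < h
  0<h = /-positive (fromℕ-positive 1) 0<d

  q*base≈m : q * base ≈ fromℕ m
  q*base≈m = *-/-cancel (fromℕ m) 0<q

  1<base : 1# < base
  1<base = *-cancelˡ-< 0<q (<-respʳ (sym q*base≈m) (<-by-difference 0<1
    -- `fromℕ m` unfolds to `1# + q`, so the solver may treat m as 1 + q, here and below.
    (solve 1 (λ q → con (+ 1) :+ q :- q :* con (+ 1) := con (+ 1)) refl q)))

  0<base : 0# < base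
  0<base = <-trans 0<1 1<base

  q^*base^≈m^ : ∀ n → q ^ n * base ^ n ≈ fromℕ m ^ n
  q^*base^≈m^ n = trans (sym (^-distrib-* q base n)) (^-congˡ n q*base≈m)

  M≈m*base^ : M ≈ fromℕ m * base ^ suc p
  M≈m*base^ = begin
    fromℕ m * fromℕ m ^ n / q ^ n               ≈⟨ *-congʳ (*-congˡ (q^*base^≈m^ n)) ⟨
    fromℕ m * (q ^ n * base ^ n) / q ^ n        ≈⟨ solve 4 (λ m x y z → m :* (x :* y) :* z := m :* y :* (x :* z))
                                                     refl (fromℕ m) (q ^ n) (base ^ n) ((q ^ n) ⁻¹) ⟩
    fromℕ m * base ^ n * (q ^ n / q ^ n)        ≈⟨ *-congˡ (*-⁻¹ (^-positive 0<q n)) ⟩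
    fromℕ m * base ^ n * 1#                     ≈⟨ *-identityʳ _ ⟩
    fromℕ m * base ^ n                          ∎
    where
    open import Relation.Binary.Reasoning.Setoid setoid
    n = suc p

  M≈q*base^m : M ≈ q * base ^ m
  M≈q*base^m = begin
    M                             ≈⟨ M≈m*base^ ⟩
    fromℕ m * base ^ suc p        ≈⟨ *-congʳ q*base≈m ⟨
    q * base * base ^ suc p       ≈⟨ *-assoc q base (base ^ suc p) ⟩
    q * base ^ m                  ∎
    where open import Relation.Binary.Reasoning.Setoid setoid

  0<M : 0# < M
  0<M = <-respʳ (sym M≈q*base^m) (*-positive 0<q (^-positive 0<base m))

  additiveCost≈ : additiveCost ≈ (M - fromℕ m) * d
  additiveCost≈ = begin
    fromℕ m * (base ^ suc p - 1#) * d        ≈⟨ solve 3 (λ m b d → m :* (b :- con (+ 1)) :* d := (m :* b :- m) :* d)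
                                                  refl (fromℕ m) (base ^ suc p) d ⟩
    (fromℕ m * base ^ suc p - fromℕ m) * d   ≈⟨ *-congʳ (+-congʳ M≈m*base^) ⟨
    (M - fromℕ m) * d                        ∎
    where open import Relation.Binary.Reasoning.Setoid setoid

  reaches? : ∀ x ray t → Decidable (Reaches x ray t)
  reaches? x ray t k = Dec.map′
    (λ (1≤k , eq , t≤x) → record { isStep = 1≤k ; onRay = eq ; farEnough = t≤x })
    (λ r → Reaches.isStep r , Reaches.onRay r , Reaches.farEnough r)
    (1 ℕ.≤? k ×-dec (k mod m Fin.≟ ray) ×-dec (t ≤? x k))

  findsAt : ∀ x ray t k → Reaches x ray t k → ∃[ k₀ ] FindsAt x ray t k₀
  findsAt x ray t k reaches =
    let (k₀ , reaches₀ , least) = minimal-witness (reaches? x ray t) k reaches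
    in k₀ , record { reaches = reaches₀ ; least = least }

  -- Upper bound: the cost of the optimal strategy.

  module UpperBound where

    optimalSteps-isStrategy : IsStrategy optimalSteps
    optimalSteps-isStrategy = record
      { positive   = λ i 1≤i → *-positive 0<h (<⇒0<- (^-monoʳ-< 1<base 1≤i))
      ; increasing = λ i _ → *-monoˡ-< 0<h (<-by-difference
          (<⇒0<- (^-monoʳ-< 1<base (ℕ.m<m+n i (s≤s z≤n))))
          (solve 2 (λ x y → y :- con (+ 1) :- (x :- con (+ 1)) := y :- x) refl (base ^ i) (base ^ (i ℕ.+ m))))
      }

    base^suc≈ : ∀ i → q * base ^ suc i ≈ fromℕ m * base ^ i
    base^suc≈ i = trans (sym (*-assoc q base (base ^ i))) (*-congʳ q*base≈m)

    -- Bernoulli's inequality for `base` = 1 + 1/q, cleared of denominators: raising the exponent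
    -- from i to i + 1 adds `base ^ i`, at least 1, to the right side.
    fromℕ≤base^ : ∀ i → fromℕ i ≤ q * (base ^ i - 1#)
    fromℕ≤base^ zero = inj₂ (solve 1 (λ q → con (+ 0) := q :* (con (+ 1) :- con (+ 1))) refl q)
    fromℕ≤base^ (suc i) = ≤-by-difference
      (+-nonNegative (≤⇒0≤- (fromℕ≤base^ i)) (≤⇒0≤- (1≤^ (inj₁ 1<base) i)))
      (begin
        q * (base ^ suc i - 1#) - (1# + fromℕ i)
          ≈⟨ solve 3 (λ q b n → q :* (b :- con (+ 1)) :- (con (+ 1) :+ n)
               := q :* b :- q :- con (+ 1) :- n) refl q (base ^ suc i) (fromℕ i) ⟩
        q * base ^ suc i - q - 1# - fromℕ i
          ≈⟨ +-congʳ (+-congʳ (+-congʳ (base^suc≈ i))) ⟩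
        fromℕ m * base ^ i - q - 1# - fromℕ i
          ≈⟨ solve 3 (λ q b n → (con (+ 1) :+ q) :* b :- q :- con (+ 1) :- n
               := (q :* (b :- con (+ 1)) :- n) :+ (b :- con (+ 1))) refl q (base ^ i) (fromℕ i) ⟩
        (q * (base ^ i - 1#) - fromℕ i) + (base ^ i - 1#) ∎)
      where open import Relation.Binary.Reasoning.Setoid setoid

    optimalSteps-unbounded : ∀ t → ∃[ N ] (∀ i → N ℕ.≤ i → t ≤ optimalSteps i)
    optimalSteps-unbounded t =
      let (N , qt/h<N) = archimedean (q * t / h)
      in N , λ i N≤i → *-cancelˡ-≤ 0<q (begin
        q * t                       ≈⟨ *-/-cancel (q * t) 0<h ⟨
        h * (q * t / h)             ≤⟨ *-monoˡ-≤ (inj₁ 0<h) (inj₁ qt/h<N) ⟩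
        h * fromℕ N                 ≤⟨ *-monoˡ-≤ (inj₁ 0<h) (≤-trans (fromℕ-mono-≤ N≤i) (fromℕ≤base^ i)) ⟩
        h * (q * (base ^ i - 1#))   ≈⟨ solve 3 (λ h q x → h :* (q :* x) := q :* (h :* x)) refl h q (base ^ i - 1#) ⟩
        q * optimalSteps i          ∎)
      where open ≤-Reasoning

    optimalSteps-reaches : ∀ ray t → ∃[ k ] Reaches optimalSteps ray t k
    optimalSteps-reaches ray t =
      let (N , far) = optimalSteps-unbounded t
          -- A step on the given ray with index at least `N`; `suc N` keeps the index positive even
          -- for `N` = 0 and ray 0.
          k = toℕ ray ℕ.+ suc N ℕ.* m
      in k , record
        { isStep    = ℕ.≤-trans (s≤s z≤n) (ℕ.m≤n+m (suc N ℕ.* m) (toℕ ray))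
        ; onRay     = ≡.trans (%-≡⇒mod-≡ {k} {toℕ ray} m (ℕ.[m+kn]%n≡m%n (toℕ ray) (suc N) m)) (toℕ-mod ray)
        ; farEnough = far k (ℕ.≤-trans (ℕ.n≤1+n N) (ℕ.≤-trans (ℕ.m≤m*n (suc N) m) (ℕ.m≤n+m (suc N ℕ.* m) (toℕ ray))))
        }

    -- Each step costs `d * base ^ i`, so this is a geometric sum, with 1 / (base - 1) = q and q
    -- base = m. Here `k` counts the failed steps, hence the exponent `suc k` of the successful one.
    cost-before : ∀ k →
      fromℕ 2 * (∑[ i < k ] optimalSteps (suc (toℕ i))) + fromℕ k * d
        ≈ (q * base ^ suc k - fromℕ m) * d
    cost-before zero = begin
      fromℕ 2 * 0# + 0# * d               ≈⟨ solve 2 (λ q d → con (+ 2) :* con (+ 0) :+ con (+ 0) :* d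
                                               := ((con (+ 1) :+ q) :* con (+ 1) :- (con (+ 1) :+ q)) :* d) refl q d ⟩
      (fromℕ m * 1# - fromℕ m) * d        ≈⟨ *-congʳ (+-congʳ (base^suc≈ 0)) ⟨
      (q * base ^ 1 - fromℕ m) * d        ∎
      where open import Relation.Binary.Reasoning.Setoid setoid
    cost-before (suc k) = begin
      fromℕ 2 * (∑[ i < suc k ] optimalSteps (suc (toℕ i))) + fromℕ (suc k) * d
        ≈⟨ +-congʳ (*-congˡ (∑-last (optimalSteps ∘ suc) k)) ⟩
      fromℕ 2 * (S + h * (b - 1#)) + (1# + fromℕ k) * d
        ≈⟨ solve 5 (λ S h b n d → con (+ 2) :* (S :+ h :* (b :- con (+ 1))) :+ (con (+ 1) :+ n) :* d
             := (con (+ 2) :* S :+ n :* d) :+ (con (+ 2) :* h :* (b :- con (+ 1)) :+ d)) refl S h b (fromℕ k) d ⟩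
      (fromℕ 2 * S + fromℕ k * d) + (fromℕ 2 * h * (b - 1#) + d)
        ≈⟨ +-cong (cost-before k) (+-congʳ (*-congʳ 2h≈d)) ⟩
      (q * b - fromℕ m) * d + (d * (b - 1#) + d)
        ≈⟨ solve 3 (λ q b d → (q :* b :- (con (+ 1) :+ q)) :* d :+ (d :* (b :- con (+ 1)) :+ d)
             := ((con (+ 1) :+ q) :* b :- (con (+ 1) :+ q)) :* d) refl q b d ⟩
      (fromℕ m * b - fromℕ m) * d
        ≈⟨ *-congʳ (+-congʳ (base^suc≈ (suc k))) ⟨
      (q * base ^ suc (suc k) - fromℕ m) * d ∎
      where
      open import Relation.Binary.Reasoning.Setoid setoid
      b = base ^ suc k
      S = ∑[ i < k ] optimalSteps (suc (toℕ i))

    -- The terms m d cancel between the additive constant and the cost, leaving one comparison of a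
    -- power of `base` with an affine function of `t`.
    cost≤ : ∀ t k → q * base ^ suc k * d ≤ M * (fromℕ 2 * t + d) →
            cost optimalSteps t (suc k) ≤ competitiveRatio * t + additiveCost
    cost≤ t k bound = ≤-by-difference (≤⇒0≤- bound) (begin
      competitiveRatio * t + additiveCost - cost optimalSteps t (suc k)
        ≈⟨ +-cong (+-congˡ additiveCost≈) (-‿cong (+-congʳ (cost-before k))) ⟩
      (1# + fromℕ 2 * M) * t + (M - fromℕ m) * d - ((q * base ^ suc k - fromℕ m) * d + t)
        ≈⟨ solve 5 (λ M t m d b → (con (+ 1) :+ con (+ 2) :* M) :* t :+ (M :- m) :* d :- ((b :- m) :* d :+ t)
             := M :* (con (+ 2) :* t :+ d) :- b :* d) refl M t (fromℕ m) d (q * base ^ suc k) ⟩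
      M * (fromℕ 2 * t + d) - q * base ^ suc k * d ∎)
      where open import Relation.Binary.Reasoning.Setoid setoid

    -- Here nothing bounds `t` away from 0, and `M * d = q * base ^ m * d` alone has to suffice.
    first-round : ∀ {t k} → 0# < t → k ℕ.≤ m → q * base ^ k * d ≤ M * (fromℕ 2 * t + d)
    first-round {t} {k} 0<t k≤m = begin
      q * base ^ k * d         ≈⟨ *-comm _ d ⟩
      d * (q * base ^ k)       ≤⟨ *-monoˡ-≤ (inj₁ 0<d) (*-monoˡ-≤ (inj₁ 0<q) (^-monoʳ-≤ (inj₁ 1<base) k≤m)) ⟩
      d * (q * base ^ m)       ≈⟨ *-congˡ M≈q*base^m ⟨
      d * M                    ≤⟨ ≤-by-difference
                                    (*-nonNegative (inj₁ 0<M) (*-nonNegative (fromℕ-nonNegative 2) (inj₁ 0<t)))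
                                    (solve 3 (λ d M t → M :* (con (+ 2) :* t :+ d) :- d :* M := M :* (con (+ 2) :* t)) refl d M t) ⟩
      M * (fromℕ 2 * t + d)    ∎
      where open ≤-Reasoning

    -- Missing the target at turning point i gives 2 t + d > 2 x_i + d = d base^i; multiply by
    -- `M = q * base ^ m`.
    later-round : ∀ {t} i → optimalSteps i < t → q * base ^ (i ℕ.+ m) * d ≤ M * (fromℕ 2 * t + d)
    later-round {t} i x<t = begin
      q * base ^ (i ℕ.+ m) * d        ≈⟨ *-congʳ (*-congˡ (^-homo-* base i m)) ⟩
      q * (base ^ i * base ^ m) * d   ≈⟨ solve 4 (λ q x y d → q :* (x :* y) :* d := q :* y :* (d :* x)) refl q (base ^ i) (base ^ m) d ⟩
      q * base ^ m * (d * base ^ i)   ≈⟨ *-cong M≈q*base^m (*-congʳ 2h≈d) ⟨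
      M * (fromℕ 2 * h * base ^ i)    ≤⟨ *-monoˡ-≤ (inj₁ 0<M) (≤-by-difference
                                           (*-nonNegative (fromℕ-nonNegative 2) (≤⇒0≤- (inj₁ x<t)))
                                           (solve 3 (λ h b t → con (+ 2) :* t :+ con (+ 2) :* h :- con (+ 2) :* h :* b
                                               := con (+ 2) :* (t :- h :* (b :- con (+ 1)))) refl h (base ^ i) t)) ⟩
      M * (fromℕ 2 * t + fromℕ 2 * h) ≈⟨ *-congˡ (+-congˡ 2h≈d) ⟩
      M * (fromℕ 2 * t + d)           ∎
      where open ≤-Reasoning

    optimalSteps-cost : ∀ ray t → 0# < t → ∀ k → FindsAt optimalSteps ray t (suc k) →
      cost optimalSteps t (suc k) ≤ competitiveRatio * t + additiveCost
    optimalSteps-cost ray t 0<t k finds with suc k ℕ.≤? m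
    ... | yes k≤m = cost≤ t k (first-round 0<t k≤m)
    -- Step `i = suc k ∸ m` is the previous visit to the same ray. It turned before `t`, since
    -- otherwise it would contradict minimality of the finding step.
    ... | no k≰m = cost≤ t k (≡.subst (λ j → q * base ^ j * d ≤ M * (fromℕ 2 * t + d)) i+m≡k
            (later-round i (≰⇒> λ t≤x → ℕ.<⇒≱ i<k (least i (record
              { isStep    = ℕ.m<n⇒0<n∸m m<k
              ; onRay     = ≡.trans (%-≡⇒mod-≡ {i} {suc k} m
                              (≡.trans (≡.sym (ℕ.[m+n]%n≡m%n i m)) (≡.cong (ℕ._% m) i+m≡k))) onRay
              ; farEnough = t≤x
              })))))
      where
      open FindsAt finds
      open Reaches reaches
      i     = suc k ℕ.∸ m
      m<k   = ℕ.≰⇒> k≰m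
      i+m≡k = ℕ.m∸n+n≡m (ℕ.<⇒≤ m<k)
      i<k   = ≡.subst (i ℕ.<_) i+m≡k (ℕ.m<m+n i (s≤s z≤n))

    optimalSteps-findsAll : FindsAllWithin optimalSteps competitiveRatio additiveCost
    optimalSteps-findsAll ray t 0<t =
      withCost (findsAt optimalSteps ray t _ (proj₂ (optimalSteps-reaches ray t)))
      where
      withCost : ∃[ k ] FindsAt optimalSteps ray t k →
                 ∃[ k ] (FindsAt optimalSteps ray t k ×
                         cost optimalSteps t k ≤ competitiveRatio * t + additiveCost)
      withCost (zero  , finds) = ⊥-elim (ℕ.1+n≰n (Reaches.isStep (FindsAt.reaches finds)))
      withCost (suc k , finds) = suc k , finds , optimalSteps-cost ray t 0<t k finds

  -- Lower bound: refuting a smaller additive constant.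

  module LowerBound
    {B : Carrier} {x : Steps} (strategy : IsStrategy x)
    (findsAll : FindsAllWithin x competitiveRatio B) (B<additiveCost : B < additiveCost)
    where

    open IsStrategy strategy

    -- The origin as turning point of step 0, for targets close to it.
    x₀ : Steps
    x₀ zero    = 0#
    x₀ (suc i) = x (suc i)

    x₀-nonNegative : ∀ n → 0# ≤ x₀ n
    x₀-nonNegative zero    = ≤-refl
    x₀-nonNegative (suc n) = inj₁ (positive (suc n) (s≤s z≤n))

    x≤x+jm : ∀ j k → 1 ℕ.≤ k → x k ≤ x (k ℕ.+ j ℕ.* m)
    x≤x+jm zero k 1≤k = inj₂ (reflexive (≡.cong x (≡.sym (ℕ.+-identityʳ k))))
    x≤x+jm (suc j) k 1≤k = begin
      x k                          <⟨ increasing k 1≤k ⟩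
      x (k ℕ.+ m)                  ≤⟨ x≤x+jm j (k ℕ.+ m) (ℕ.≤-trans 1≤k (ℕ.m≤m+n k m)) ⟩
      x (k ℕ.+ m ℕ.+ j ℕ.* m)      ≡⟨ ≡.cong x (ℕ.+-assoc k m (j ℕ.* m)) ⟩
      x (k ℕ.+ (m ℕ.+ j ℕ.* m))    ∎
      where open ≤-Reasoning

    -- An earlier step on this ray has an index smaller than n + m and congruent to n, so it is n
    -- less a multiple of m. Its turning point is at most `x₀ n`, short of `t`.
    reached-a-round-later : ∀ {t} n k → x₀ n < t → Reaches x (n mod m) t k → n ℕ.+ m ℕ.≤ k
    reached-a-round-later {t} n zero x₀<t reaches with () ← Reaches.isStep reaches
    reached-a-round-later {t} n (suc k) x₀<t reaches with n ℕ.+ m ℕ.≤? suc k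
    ... | yes n+m≤k = n+m≤k
    ... | no n+m≰k with mod-≡∧<⇒multiple {suc k} {n} m (Reaches.onRay reaches) (ℕ.≰⇒> n+m≰k)
    -- The match replaces `n` by `suc k + j * m`, which rules out `n` = 0 and lets `x₀ n` reduce to
    -- a value of `x`.
    ...   | j , ≡.refl = ⊥-elim (<⇒≱ x₀<t
              (≤-trans (Reaches.farEnough reaches) (x≤x+jm j (suc k) (s≤s z≤n))))

    -- V (1 + n) is the cost of the first n steps, shifted so that the
    -- recurrence becomes homogeneous.
    V : ℕ → Carrier
    V zero    = M * d - B - d
    V (suc n) = V n + (fromℕ 2 * x₀ n + d)

    0≤step : ∀ n → 0# ≤ fromℕ 2 * x₀ n + d
    0≤step n = +-nonNegative (*-nonNegative (fromℕ-nonNegative 2) (x₀-nonNegative n)) (inj₁ 0<d)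

    -- This is the assumption on `B` in terms of `V`: the difference of the two sides equals
    -- `additiveCost - B`.
    q*d<V₀ : q * d < V 0
    q*d<V₀ = <-by-difference (<⇒0<- B<additiveCost) (begin
      M * d - B - d - q * d        ≈⟨ solve 4 (λ M B d q → M :* d :- B :- d :- q :* d
                                        := (M :- (con (+ 1) :+ q)) :* d :- B) refl M B d q ⟩
      (M - fromℕ m) * d - B        ≈⟨ +-congʳ additiveCost≈ ⟨
      additiveCost - B             ∎)
      where open import Relation.Binary.Reasoning.Setoid setoid

    V-mono-+ : ∀ n j → V n ≤ V (j ℕ.+ n)
    V-mono-+ n zero    = ≤-refl
    V-mono-+ n (suc j) = ≤-trans (V-mono-+ n j) (≤-by-difference (0≤step (j ℕ.+ n))
      (solve 2 (λ v z → v :+ z :- v := z) refl (V (j ℕ.+ n)) (fromℕ 2 * x₀ (j ℕ.+ n) + d)))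

    V-mono-≤ : ∀ {n k} → n ℕ.≤ k → V n ≤ V k
    V-mono-≤ {n} {k} n≤k = ≡.subst (λ l → V n ≤ V l) (ℕ.m∸n+n≡m n≤k) (V-mono-+ n (k ℕ.∸ n))

    V-positive : ∀ n → 0# < V n
    V-positive n = begin-strict
      0#       <⟨ *-positive 0<q 0<d ⟩
      q * d    <⟨ q*d<V₀ ⟩
      V 0      ≤⟨ V-mono-≤ {k = n} z≤n ⟩
      V n      ∎
      where open ≤-Reasoning

    V-suc≈ : ∀ n → V (suc n) ≈ M * d - B + (fromℕ 2 * (∑[ i < n ] x (suc (toℕ i))) + fromℕ n * d)
    V-suc≈ zero = solve 3 (λ M d B → M :* d :- B :- d :+ (con (+ 2) :* con (+ 0) :+ d)
      := M :* d :- B :+ (con (+ 2) :* con (+ 0) :+ con (+ 0) :* d)) refl M d B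
    V-suc≈ (suc n) = begin
      V (suc n) + (fromℕ 2 * y + d)
        ≈⟨ +-congʳ (V-suc≈ n) ⟩
      a + (fromℕ 2 * S + fromℕ n * d) + (fromℕ 2 * y + d)
        ≈⟨ solve 5 (λ a S n d y → a :+ (con (+ 2) :* S :+ n :* d) :+ (con (+ 2) :* y :+ d)
             := a :+ (con (+ 2) :* (S :+ y) :+ (con (+ 1) :+ n) :* d)) refl a S (fromℕ n) d y ⟩
      a + (fromℕ 2 * (S + y) + fromℕ (suc n) * d)
        ≈⟨ +-congˡ (+-congʳ (*-congˡ (∑-last (x ∘ suc) n))) ⟨
      a + (fromℕ 2 * (∑[ i < suc n ] x (suc (toℕ i))) + fromℕ (suc n) * d) ∎
      where
      open import Relation.Binary.Reasoning.Setoid setoid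
      a = M * d - B
      S = ∑[ i < n ] x (suc (toℕ i))
      y = x (suc n)

    -- The shift `M * d - B` in `V` trades the constant `B` of the cost bound for `M * d`. At
    -- `t = x₀ n` the right side then becomes `M` times the increment of `V` at `n`.
    V≤ : ∀ t k → cost x t (suc k) ≤ competitiveRatio * t + B → V (suc k) ≤ M * fromℕ 2 * t + M * d
    V≤ t k bound = ≤-respˡ (sym (V-suc≈ k)) (≤-by-difference (≤⇒0≤- bound)
      (solve 5 (λ M d B C t → M :* con (+ 2) :* t :+ M :* d :- (M :* d :- B :+ C)
          := (con (+ 1) :+ con (+ 2) :* M) :* t :+ B :- (C :+ t)) refl M d B
        (fromℕ 2 * (∑[ i < k ] x (suc (toℕ i))) + fromℕ k * d) t))

    -- The target is placed on the ray of step n, so the finding step is at least n + m. As `V` is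
    -- monotone, the bound at the finding step passes down to `V (n + m)`.
    V-bound-beyond : ∀ n t → x₀ n < t → V (n ℕ.+ m) ≤ M * fromℕ 2 * t + M * d
    V-bound-beyond n t x₀<t = bound (findsAll (n mod m) t (≤-<-trans (x₀-nonNegative n) x₀<t))
      where
      bound : ∃[ k ] (FindsAt x (n mod m) t k × cost x t k ≤ competitiveRatio * t + B) →
              V (n ℕ.+ m) ≤ M * fromℕ 2 * t + M * d
      bound (zero  , finds , _) = ⊥-elim (ℕ.1+n≰n (Reaches.isStep (FindsAt.reaches finds)))
      bound (suc k , finds , cost≤) =
        ≤-trans (V-mono-≤ (reached-a-round-later n (suc k) x₀<t (FindsAt.reaches finds))) (V≤ t k cost≤)

    V-recurrence : ∀ n → V (2 ℕ.+ p ℕ.+ n) ≤ M * (V (suc n) - V n)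
    V-recurrence n = begin
      V (m ℕ.+ n)                       ≡⟨ ≡.cong V (ℕ.+-comm m n) ⟩
      -- At `t = x₀ n` itself step n could find the target, or for n = 0 the target would sit at the
      -- origin; hence the limit from beyond.
      V (n ℕ.+ m)                       ≤⟨ ≤-at-limit (*-positive 0<M (fromℕ-positive 1)) (V-bound-beyond n) ⟩
      M * fromℕ 2 * x₀ n + M * d        ≈⟨ solve 4 (λ M y d v → M :* con (+ 2) :* y :+ M :* d
                                             := M :* (v :+ (con (+ 2) :* y :+ d) :- v)) refl M (x₀ n) d (V n) ⟩
      M * (V (suc n) - V n)             ∎
      where open ≤-Reasoning

    -- Because `x₀ 0` is 0, V 1 / V 0 = 1 + d / V 0, which is below base = 1 + 1/q as soon as q d <
    -- V 0.
    V₁<base*V₀ : V 1 < base * V 0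
    V₁<base*V₀ = *-cancelˡ-< 0<q (<-by-difference (<⇒0<- q*d<V₀) (begin
      q * (base * V 0) - q * V 1                       ≈⟨ +-congʳ (*-assoc q base (V 0)) ⟨
      q * base * V 0 - q * V 1                         ≈⟨ +-congʳ (*-congʳ q*base≈m) ⟩
      fromℕ m * V 0 - q * V 1                          ≈⟨ solve 3 (λ q v d → (con (+ 1) :+ q) :* v :- q :* (v :+ (con (+ 2) :* con (+ 0) :+ d))
                                                            := v :- q :* d) refl q (V 0) d ⟩
      V 0 - q * d                                      ∎))
      where open import Relation.Binary.Reasoning.Setoid setoid

    contradiction : ⊥
    contradiction = <⇒≱ V₁<base*V₀
      (CriticalGrowth.critical-growth p 0<base M≈m*base^ M≈q*base^m V V-positive V-recurrence)

theorem7 : ∀ {c ℓ₁ ℓ₂} (ℝ : CompleteOrderedField c ℓ₁ ℓ₂) →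
    let open CompleteOrderedField ℝ in
    ∀ (m : ℕ) .{{_ : NonZero m}} → 2 ℕ.≤ m →
    ∀ (d : Carrier) → 0# < d →
    let open StarSearch ℝ m d in
    (IsStrategy optimalSteps × FindsAllWithin optimalSteps competitiveRatio additiveCost)
    ×
    (∀ (B : Carrier) (x : Steps) → IsStrategy x → FindsAllWithin x competitiveRatio B → additiveCost ≤ B)
theorem7 ℝ (suc (suc p)) (s≤s (s≤s _)) d 0<d =
  (optimalSteps-isStrategy , optimalSteps-findsAll) ,
  λ B x strategy findsAll → ≮⇒≥ λ B<additiveCost →
    LowerBound.contradiction strategy findsAll B<additiveCost
  where
  open OrderedFieldProperties ℝ using (≮⇒≥)
  open StarSearchProperties ℝ p d 0<d
  open UpperBound
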